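{- For every integer $k\geq 2$ and every bipartite graph $G$ containing at most one cycle, $\nu_{k}(G) \geq \frac{\nu_{k-1}(G) + \nu_{k+1}(G)}{2}$.
   Context: Graphs are finite, without loops, possibly with multiple edges. For $k\geq 1$, $\nu_k(G)$ is the maximum number of edges of a $k$-edge-colorable subgraph of $G$. -}

module Defs where

open import Data.Bool.Base using (Bool)
open import Data.Empty using (⊥-elim; ⊥-elim-irr)
open import Data.Fin.Base using (Fin; zero; toℕ; finToFun; funToFin)
open import Data.Fin.Properties using (_≟_; all?; any?; ¬Fin0; finToFun-funToFin)
open import Data.Fin.Subset using (Subset; _∈_; ∣_∣; ⊥)
open import Data.Fin.Subset.Properties using (_∈?_; anySubset?; nonempty?; ∉⊥; ∣⊥∣≡0; ∣p∣≤n)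
open import Data.Nat.Base using (ℕ; zero; suc; _+_; _^_; _≤_; s≤s⁻¹)
open import Data.Nat.DivMod using (_mod_)
open import Data.Nat.Properties using (≤∧≢⇒<) renaming (_≟_ to _≟ℕ_)
open import Data.Product using (Σ-syntax; ∃; ∃-syntax; _×_; _,_; proj₁; proj₂)
open import Data.Sum.Base using (_⊎_)
open import Function.Bundles using (_⇔_)
open import Function.Definitions using (Injective)
open import Relation.Binary.PropositionalEquality using (_≡_; _≢_; sym; trans)
open import Relation.Nullary using (Dec; yes; no)
open import Relation.Nullary.Decidable using (map′; ¬?; _×-dec_; _⊎-dec_; _→-dec_)

-- The ends of an edge come as an ordered pair, but nothing below depends on
-- the order.  Different edges may have the same ends.
record Multigraph : Set where
  field
    #V #E    : ℕ
    src tgt  : Fin #E → Fin #V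
    loopless : ∀ e → src e ≢ tgt e

  V E : Set
  V = Fin #V
  E = Fin #E

  Incident : V → E → Set
  Incident v e = src e ≡ v ⊎ tgt e ≡ v

  Joins : E → V → V → Set
  Joins e u v = (src e ≡ u × tgt e ≡ v) ⊎ (src e ≡ v × tgt e ≡ u)

  Adjacent : E → E → Set
  Adjacent e f = e ≢ f × ∃[ v ] Incident v e × Incident v f

open Multigraph

Bipartite : Multigraph → Set
Bipartite G = Σ[ side ∈ (V G → Bool) ] (∀ e → side (src G e) ≢ side (tgt G e))

-- A cycle of length n = 2 + l visits distinct vertices v₀, …, vₙ₋₁ along
-- distinct edges eᵢ joining vᵢ to vᵢ₊₁ (indices modulo n).  Two parallel edges
-- form a cycle of length 2.
record Cycle (G : Multigraph) : Set where
  field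
    l : ℕ

  len : ℕ
  len = 2 + l

  next : Fin len → Fin len
  next i = suc (toℕ i) mod (2 + l)

  field
    vertex          : Fin len → V G
    edge            : Fin len → E G
    vertex-distinct : Injective _≡_ _≡_ vertex
    edge-distinct   : Injective _≡_ _≡_ edge
    joins           : ∀ i → Joins G (edge i) (vertex i) (vertex (next i))

_on_ : ∀ {G} → E G → Cycle G → Set
e on C = ∃[ i ] Cycle.edge C i ≡ e

-- Cycles are counted as subgraphs, so that the starting vertex and the
-- direction of traversal do not matter.  The edges of a cycle determine its
-- vertices.
AtMostOneCycle : Multigraph → Set
AtMostOneCycle G = (C D : Cycle G) → ∀ e → (e on C) ⇔ (e on D)

-- A subgraph is given by its set of edges S: its isolated vertices affect
-- neither its edge-colorability nor its number of edges.
record EdgeColoring (G : Multigraph) (S : Subset (#E G)) (k : ℕ) : Set where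
  field
    color  : (e : E G) → .(e ∈ S) → Fin k
    proper : ∀ e f (p : e ∈ S) (q : f ∈ S) → Adjacent G e f → color e p ≢ color f q

open EdgeColoring

IsMaxColorable : Multigraph → ℕ → ℕ → Set
IsMaxColorable G k x =
  (∃[ S ] EdgeColoring G S k × ∣ S ∣ ≡ x) ×
  (∀ S → EdgeColoring G S k → ∣ S ∣ ≤ x)

module _ (G : Multigraph) where

  private
    incident? : ∀ v e → Dec (Incident G v e)
    incident? v e = (src G e ≟ v) ⊎-dec (tgt G e ≟ v)

    adjacent? : ∀ e f → Dec (Adjacent G e f)
    adjacent? e f = ¬? (e ≟ f) ×-dec any? (λ v → incident? v e ×-dec incident? v f)

    TotalProper : ∀ {k} → Subset (#E G) → (E G → Fin k) → Set
    TotalProper S c = ∀ e f → e ∈ S → f ∈ S → Adjacent G e f → c e ≢ c f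

    totalProper? : ∀ {k} S (c : E G → Fin k) → Dec (TotalProper S c)
    totalProper? S c = all? λ e → all? λ f →
      (e ∈? S) →-dec ((f ∈? S) →-dec (adjacent? e f →-dec ¬? (c e ≟ c f)))

  edgeColoring? : ∀ k S → Dec (EdgeColoring G S k)
  edgeColoring? zero S with nonempty? S
  ... | yes (e , e∈S) = no λ γ → ¬Fin0 (color γ e e∈S)
  ... | no  S-empty = yes record
    { color  = λ e e∈S → ⊥-elim-irr (S-empty (e , e∈S))
    ; proper = λ e _ p → ⊥-elim (S-empty (e , p))
    }
  edgeColoring? (suc k) S =
    map′ from to (any? {n = suc k ^ #E G} λ x → totalProper? S (finToFun x))
    where
    from : (∃ λ x → TotalProper S (finToFun {suc k} x)) → EdgeColoring G S (suc k)
    from (x , h) = record { color = λ e _ → finToFun x e ; proper = h }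

    to : EdgeColoring G S (suc k) → ∃ λ x → TotalProper S (finToFun {suc k} x)
    to γ = funToFin c , λ e f p q a eq →
      c-proper e f p q a (trans (sym (finToFun-funToFin c e)) (trans eq (finToFun-funToFin c f)))
      where
      c : E G → Fin (suc k)
      c e with e ∈? S
      ... | yes e∈S = color γ e e∈S
      ... | no  _   = zero

      c-proper : TotalProper S c
      c-proper e f p q a with e ∈? S | f ∈? S
      ... | yes p′ | yes q′ = proper γ e f p′ q′ a
      ... | no ¬p  | _      = ⊥-elim (¬p p)
      ... | yes _  | no ¬q  = ⊥-elim (¬q q)

  maxColorable : ∀ k → ∃ (IsMaxColorable G k)
  maxColorable k = search (#E G) (λ S _ → ∣p∣≤n S)
    where
    ⊥-coloring : EdgeColoring G ⊥ k
    ⊥-coloring = record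
      { color  = λ e e∈⊥ → ⊥-elim-irr (∉⊥ e∈⊥)
      ; proper = λ _ _ p → ⊥-elim (∉⊥ p)
      }

    search : ∀ x → (∀ S → EdgeColoring G S k → ∣ S ∣ ≤ x) → ∃ (IsMaxColorable G k)
    search zero    ub = 0 , (⊥ , ⊥-coloring , ∣⊥∣≡0 (#E G)) , ub
    search (suc x) ub with anySubset? (λ S → edgeColoring? k S ×-dec (∣ S ∣ ≟ℕ suc x))
    ... | yes found = suc x , found , ub
    ... | no  none  = search x λ S γ → s≤s⁻¹ (≤∧≢⇒< (ub S γ) (λ eq → none (S , γ , eq)))

ν : Multigraph → ℕ → ℕ
ν G k = proj₁ (maxColorable G k)

ν-isMax : ∀ G k → IsMaxColorable G k (ν G k)
ν-isMax G k = proj₂ (maxColorable G k)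

{-# OPTIONS --safe #-}
-- Take extremal S₁ and S₂ for k − 1 and k + 1 colors, and divide the edges of
-- S₁ △ S₂ so evenly that at every vertex the halves differ by at most one.  Adding
-- S₁ ∩ S₂ to both halves gives two edge sets with |S₁| + |S₂| edges in total
-- and with all degrees at most k, which are k-edge-colorable by König's theorem.
--
-- Both the even division and the recoloring step in König's theorem come from
-- one fact: pairing up edges at their ends on each side of the bipartition
-- yields two partial involutions of the edges, and some 2-coloring of the edges
-- separates all the pairs.
module Submission where

open import Defs
open import Data.Bool.Base using (Bool; true; false; not; _∧_; _∨_; _xor_; if_then_else_)
open import Data.Bool.Properties using (∧-identityʳ; ∧-zeroʳ; not-involutive; not-¬; ¬-not) renaming (_≟_ to _≟ᵇ_)
open import Data.Fin.Base using (Fin; zero; suc)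
open import Data.Fin.Permutation using (permutation)
open import Data.Fin.Properties using (_≟_; any?; suc-injective; 0≢1+n)
open import Data.Fin.Subset using (Subset; _∈_; ∣_∣)
open import Data.Fin.Subset.Properties using (_∈?_)
open import Data.Integer.Base as ℤ using (+_)
import Data.Integer.Properties as ℤ
open import Data.Nat.Base using (ℕ; zero; suc; _≤_; _<_; _+_; _∸_; z≤n; s≤s; s≤s⁻¹)
import Data.Nat.Properties as ℕ
open import Algebra.Properties.CommutativeMonoid.Sum ℕ.+-0-commutativeMonoid
  using (sum-cong-≗; ∑-distrib-+; ∑-comm; sum-permute) renaming (sum to ∑)
open import Data.Product using (∃-syntax; _×_; _,_; proj₁; proj₂)
open import Data.Rational.Base using (_/_; _≥_)
open import Data.Rational.Properties using (toℚᵘ-cancel-≤; toℚᵘ-fromℚᵘ)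
open import Data.Rational.Unnormalised.Base using (mkℚᵘ; *≤*)
import Data.Rational.Unnormalised.Properties as ℚᵘ
open import Data.Sum.Base using (_⊎_; inj₁; inj₂)
open import Data.Vec.Base using (_∷_; []; lookup; tabulate)
open import Data.Vec.Properties using ([]=⇒lookup; lookup⇒[]=; lookup∘tabulate)
open import Function.Base using (_∘_)
open import Relation.Binary.PropositionalEquality
  using (_≡_; _≢_; refl; sym; trans; cong; cong₂; subst; module ≡-Reasoning)
open import Relation.Nullary using (Dec; yes; no; does; contradiction)
open import Relation.Nullary.Decidable using (dec-true; _×-dec_)

-- Counting with Boolean predicates.

𝟙 : Bool → ℕ
𝟙 true  = 1
𝟙 false = 0

# : ∀ {m} → (Fin m → Bool) → ℕ
# P = ∑ (𝟙 ∘ P)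

∑-mono-≤ : ∀ {n} {f g : Fin n → ℕ} → (∀ i → f i ≤ g i) → ∑ f ≤ ∑ g
∑-mono-≤ {zero}  h = z≤n
∑-mono-≤ {suc n} h = ℕ.+-mono-≤ (h zero) (∑-mono-≤ (h ∘ suc))

∑-exchange : ∀ {n} (f g f′ g′ : Fin n → ℕ) →
  (∀ i → f i + g i ≡ f′ i + g′ i) → ∑ f + ∑ g ≡ ∑ f′ + ∑ g′
∑-exchange f g f′ g′ h =
  trans (sym (∑-distrib-+ f g)) (trans (sum-cong-≗ h) (∑-distrib-+ f′ g′))

∑-ones : ∀ n → ∑ {n} (λ _ → 1) ≡ n
∑-ones zero    = refl
∑-ones (suc n) = cong suc (∑-ones n)

∧-true : ∀ {x y} → x ∧ y ≡ true → x ≡ true × y ≡ true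
∧-true {true} {true} _ = refl , refl

does-true : ∀ {A : Set} (d : Dec A) → does d ≡ true → A
does-true (yes a) _ = a

#-positive : ∀ {m} (P : Fin m → Bool) i → P i ≡ true → 1 ≤ # P
#-positive P zero    eq rewrite eq = s≤s z≤n
#-positive P (suc i) eq = ℕ.≤-trans (#-positive (P ∘ suc) i eq) (ℕ.m≤n+m _ (𝟙 (P zero)))

#-empty : ∀ {m} (P : Fin m → Bool) → (∀ i → P i ≢ true) → # P ≡ 0
#-empty {zero}  P h = refl
#-empty {suc m} P h rewrite ¬-not (h zero) = #-empty (P ∘ suc) (h ∘ suc)

#-atMostOne : ∀ {m} (P : Fin m → Bool) →
  (∀ i j → P i ≡ true → P j ≡ true → i ≡ j) → # P ≤ 1
#-atMostOne {zero}  P h = z≤n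
#-atMostOne {suc m} P h with P zero in eq
... | true  = s≤s (ℕ.≤-reflexive (#-empty (P ∘ suc) λ i Pi → 0≢1+n (h zero (suc i) eq Pi)))
... | false = #-atMostOne (P ∘ suc) λ i j Pi Pj → suc-injective (h (suc i) (suc j) Pi Pj)

#-singleton : ∀ {k} (a : Fin k) → # (λ b → does (a ≟ b)) ≡ 1
#-singleton a = ℕ.≤-antisym
  (#-atMostOne _ λ i j p q → trans (sym (does-true (a ≟ i) p)) (does-true (a ≟ j) q))
  (#-positive _ a (dec-true (a ≟ a) refl))

#-partition : ∀ {m k} (P : Fin m → Bool) (c : Fin m → Fin k) →
  # P ≡ ∑ (λ a → # (λ e → P e ∧ does (c e ≟ a)))
#-partition P c = trans
  (sum-cong-≗ λ e → pointwise (P e) (c e))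
  (∑-comm (λ e a → 𝟙 (P e ∧ does (c e ≟ a))))
  where
  pointwise : ∀ x a → 𝟙 x ≡ # (λ b → x ∧ does (a ≟ b))
  pointwise true  a = sym (#-singleton a)
  pointwise false a = sym (#-empty (λ b → false ∧ does (a ≟ b)) λ _ ())

-- Degrees and proper colorings at one side of the bipartition.

degree : ∀ {m n} → (Fin m → Fin n) → (Fin m → Bool) → Fin n → ℕ
degree p S v = # (λ e → S e ∧ does (p e ≟ v))

-- One side at a time: in a bipartite graph two edges with a common vertex meet it on the same side,
-- so properness is the conjunction of this condition over the two sides.
Proper : ∀ {m n k} → (Fin m → Fin n) → (Fin m → Bool) → (Fin m → Fin k) → Set
Proper p S c = ∀ e f → S e ≡ true → S f ≡ true → p e ≡ p f → c e ≡ c f → e ≡ f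

-- Each color occurs on at most one edge at `v`, so counting these edges by color gives the bound.
proper⇒degree≤ : ∀ {m n k} (p : Fin m → Fin n) S (c : Fin m → Fin k) →
  Proper p S c → ∀ v → degree p S v ≤ k
proper⇒degree≤ {k = k} p S c proper v = begin
  degree p S v                                               ≡⟨ #-partition _ c ⟩
  ∑ (λ a → # (λ e → (S e ∧ does (p e ≟ v)) ∧ does (c e ≟ a))) ≤⟨ ∑-mono-≤ one ⟩
  ∑ {k} (λ _ → 1)                                            ≡⟨ ∑-ones k ⟩
  k                                                          ∎
  where
  open ℕ.≤-Reasoning
  one : ∀ a → # (λ e → (S e ∧ does (p e ≟ v)) ∧ does (c e ≟ a)) ≤ 1
  one a = #-atMostOne _ λ e f Pe Pf →
    let (Se∧ , ce) = ∧-true Pe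
        (Sf∧ , cf) = ∧-true Pf
        (Se , pe) = ∧-true Se∧
        (Sf , pf) = ∧-true Sf∧
    in proper e f Se Sf
         (trans (does-true (p e ≟ v) pe) (sym (does-true (p f ≟ v) pf)))
         (trans (does-true (c e ≟ a) ce) (sym (does-true (c f ≟ a) cf)))

-- Pigeonhole: if every color occurred at `v`, counting by color would give degree at least `k`.
missingColor : ∀ {m n k} (p : Fin m → Fin n) S (c : Fin m → Fin k) v → degree p S v < k →
  ∃[ a ] ∀ e → S e ≡ true → p e ≡ v → c e ≢ a
missingColor {k = k} p S c v d<k
  with any? (λ a → # (λ e → (S e ∧ does (p e ≟ v)) ∧ does (c e ≟ a)) ℕ.≟ 0)
... | yes (a , none) = a , λ e Se pe ce → ℕ.1+n≰n (subst (1 ≤_) none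
        (#-positive _ e (cong₂ _∧_ (cong₂ _∧_ Se (dec-true (p e ≟ v) pe)) (dec-true (c e ≟ a) ce))))
... | no all-present = contradiction d<k (ℕ.≤⇒≯ (begin
  k                                                          ≡⟨ ∑-ones k ⟨
  ∑ {k} (λ _ → 1)                                            ≤⟨ ∑-mono-≤ (λ a → ℕ.n≢0⇒n>0 (λ z → all-present (a , z))) ⟩
  ∑ (λ a → # (λ e → (S e ∧ does (p e ≟ v)) ∧ does (c e ≟ a))) ≡⟨ #-partition _ c ⟨
  degree p S v                                               ∎))
  where open ℕ.≤-Reasoning

-- Alternating 2-colorings for an involution of the slots.

-- The edge e is split into two slots (e , false) and (e , true), one for each
-- end, and the slots receive opposite values.  So a single involution of the
-- slots represents the pairings on both sides, and deleting an edge amounts to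
-- linking the partners of its two slots with each other.
Slot : ℕ → Set
Slot m = Fin m × Bool

lift : ∀ {m} → Slot m → Slot (suc m)
lift (i , b) = suc i , b

value : ∀ {m} → (Fin m → Bool) → Slot m → Bool
value col (i , b) = b xor col i

module Contraction {m} (J : Slot (suc m) → Slot (suc m)) (J² : ∀ s → J (J s) ≡ s) where

  lift-injective : ∀ {s t : Slot m} → lift s ≡ lift t → s ≡ t
  lift-injective refl = refl

  J-sym : ∀ {s t} → J s ≡ t → J t ≡ s
  J-sym {s} eq = trans (cong J (sym eq)) (J² s)

  land : Slot m → Slot (suc m) → Slot m
  -- Here `s` leads to one slot of `zero` and the other slot is its own partner, so `s` is left
  -- without a partner.
  land s (zero  , _) = s
  land s (suc j , d) = j , d

  hop : Slot m → Slot (suc m) → Slot m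
  hop s (zero  , c) = land s (J (zero , not c))
  hop s (suc j , d) = j , d

  K : Slot m → Slot m
  K s = hop s (J (lift s))

  K-direct : ∀ {s t} → J (lift s) ≡ lift t → K s ≡ t
  K-direct eq rewrite eq = refl

  K-through : ∀ {s t} c → J (lift s) ≡ (zero , c) → J (zero , not c) ≡ lift t → K s ≡ t
  K-through c eq eq′ rewrite eq | eq′ = refl

  K-stop : ∀ {s d} c → J (lift s) ≡ (zero , c) → J (zero , not c) ≡ (zero , d) → K s ≡ s
  K-stop c eq eq′ rewrite eq | eq′ = refl

  K² : ∀ s → K (K s) ≡ s
  K² s with J (lift s) in eq
  ... | suc j , d = K-direct (J-sym eq)
  ... | zero , c with J (zero , not c) in eq′
  -- Traversed backwards, the path enters `zero` at the slot `not c` and leaves it at `c`.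
  ...   | suc j , d = K-through (not c) (J-sym eq′)
                        (trans (cong (λ b → J (zero , b)) (not-involutive c)) (J-sym eq))
  ...   | zero , d  = K-stop c eq eq′

-- Induction on the number of edges. A coloring of the contraction extends to `zero` by making one
-- slot of `zero` differ from its partner. If the other slot also has a partner among the remaining
-- edges, `K` links the two partners, so their values are opposite, just as those of the two slots
-- of `zero` are.
alternate : ∀ {m} (J : Slot m → Slot m) → (∀ s → J (J s) ≡ s) →
  ∃[ col ] ∀ s t → J s ≡ t → s ≢ t → value col s ≡ not (value col t)
alternate {zero}  J J² = (λ ()) , λ { (() , _) }
alternate {suc m} J J² = col , alt
  where
  open Contraction J J²

  col⁻ = proj₁ (alternate K K²)
  alt⁻ = proj₂ (alternate K K²)

  first : Slot (suc m) → Slot (suc m) → Bool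
  first (suc j , d) _           = not (value col⁻ (j , d))
  -- No negation: the value of the slot `(zero , true)` is already the negated color of `zero`.
  first (zero , _)  (suc j , d) = value col⁻ (j , d)
  -- No other edge constrains `zero`, so any color will do.
  first (zero , _)  (zero , _)  = false

  col : Fin (suc m) → Bool
  col zero    = first (J (zero , false)) (J (zero , true))
  col (suc i) = col⁻ i

  at-zero : ∀ b t → J (zero , b) ≡ lift t → value col (zero , b) ≡ not (value col⁻ t)
  at-zero false t eq rewrite eq = refl
  at-zero true  t eq with J (zero , false) in eq′
  ... | zero  , _ rewrite eq = refl
  ... | suc j , d = trans (not-involutive _)
                      (alt⁻ (j , d) t (K-through false (J-sym eq′) eq) distinct)
    where
    -- A common partner would be sent by `J` to both slots of `zero`.
    distinct : (j , d) ≢ t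
    distinct refl with trans (sym (J-sym eq′)) (J-sym eq)
    ... | ()

  flip : ∀ {x y} → x ≡ not y → y ≡ not x
  flip refl = sym (not-involutive _)

  alt : ∀ s t → J s ≡ t → s ≢ t → value col s ≡ not (value col t)
  alt (suc i , b)    (suc j , d)    eq s≢t =
    alt⁻ (i , b) (j , d) (K-direct eq) (s≢t ∘ cong lift)
  alt (zero , b)     (suc j , d)    eq _   = at-zero b (j , d) eq
  alt (suc i , b)    (zero , d)     eq _   = flip (at-zero d (i , b) (J-sym eq))
  alt (zero , false) (zero , true)  _  _   = sym (not-involutive _)
  alt (zero , true)  (zero , false) _  _   = refl
  alt (zero , false) (zero , false) _  s≢t = contradiction refl s≢t
  alt (zero , true)  (zero , true)  _  s≢t = contradiction refl s≢t

-- Pairing edges at their common ends.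

-- Unpaired edges are encoded as fixed points, which makes `mate` a permutation of all edges, along
-- which sums can be reindexed. The field `maximal` is the source of the imbalance of at most one
-- per vertex.
record Pairing {m n} (p : Fin m → Fin n) (D : Fin m → Bool) : Set where
  field
    mate       : Fin m → Fin m
    involutive : ∀ e → mate (mate e) ≡ e
    same-end   : ∀ e → p (mate e) ≡ p e
    support    : ∀ e → mate e ≢ e → D e ≡ true
    maximal    : ∀ e f → D e ≡ true → D f ≡ true → p e ≡ p f →
                 mate e ≡ e → mate f ≡ f → e ≡ f

-- Greedy: the new edge takes a still unpaired edge `g` of `D` at its end if there is one, and
-- otherwise stays unpaired.
pairing : ∀ {m n} (p : Fin m → Fin n) D → Pairing p D
pairing {zero}  p D = record
  { mate = λ () ; involutive = λ () ; same-end = λ () ; support = λ () ; maximal = λ () }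
pairing {suc m} p D
  with pairing (p ∘ suc) (D ∘ suc)
... | P with D zero ≟ᵇ true ×-dec
             any? (λ f → D (suc f) ≟ᵇ true ×-dec (p (suc f) ≟ p zero ×-dec Pairing.mate P f ≟ f))
... | no unmatched = record
  { mate       = mate′
  ; involutive = λ { zero → refl ; (suc e) → cong suc (involutive e) }
  ; same-end   = λ { zero → refl ; (suc e) → same-end e }
  ; support    = λ { zero ne → contradiction refl ne ; (suc e) ne → support e (ne ∘ cong suc) }
  ; maximal    = max
  }
  where
  open Pairing P
  mate′ : Fin (suc m) → Fin (suc m)
  mate′ zero    = zero
  mate′ (suc e) = suc (mate e)
  max : ∀ e f → D e ≡ true → D f ≡ true → p e ≡ p f → mate′ e ≡ e → mate′ f ≡ f → e ≡ f
  max zero    zero    _  _  _  _  _  = refl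
  max zero    (suc f) De Df pe _  ff =
    contradiction (De , f , Df , sym pe , suc-injective ff) unmatched
  max (suc e) zero    De Df pe ee _  =
    contradiction (Df , e , De , pe , suc-injective ee) unmatched
  max (suc e) (suc f) De Df pe ee ff =
    cong suc (maximal e f De Df pe (suc-injective ee) (suc-injective ff))
... | yes (D0 , g , Dg , pg , gg) = record
  { mate       = mate′
  ; involutive = inv
  ; same-end   = same
  ; support    = supp
  ; maximal    = max
  }
  where
  open Pairing P
  mate′ : Fin (suc m) → Fin (suc m)
  mate′ zero    = suc g
  mate′ (suc e) = if does (e ≟ g) then zero else suc (mate e)

  inv : ∀ e → mate′ (mate′ e) ≡ e
  inv zero rewrite dec-true (g ≟ g) refl = refl
  inv (suc e) with e ≟ g
  ... | yes refl = refl
  ... | no e≢g with mate e ≟ g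
  ...   | yes eq = contradiction (trans (sym (involutive e)) (trans (cong mate eq) gg)) e≢g
  ...   | no _   = cong suc (involutive e)

  same : ∀ e → p (mate′ e) ≡ p e
  same zero = pg
  same (suc e) with e ≟ g
  ... | yes refl = sym pg
  ... | no _     = same-end e

  supp : ∀ e → mate′ e ≢ e → D e ≡ true
  supp zero _ = D0
  supp (suc e) ne with e ≟ g
  ... | yes refl = Dg
  ... | no _     = support e (ne ∘ cong suc)

  max : ∀ e f → D e ≡ true → D f ≡ true → p e ≡ p f → mate′ e ≡ e → mate′ f ≡ f → e ≡ f
  max (suc e) (suc f) De Df pe ee ff with e ≟ g | f ≟ g
  ... | no _ | no _ = cong suc (maximal e f De Df pe (suc-injective ee) (suc-injective ff))

-- The hypothesis allows at most two edges of `D` at a vertex. By maximality `e` and `f` are not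
-- both fixed, and the mate of a moved one is an edge of `D` at the same vertex, hence the other
-- one.
mate-of : ∀ {m n} {p : Fin m → Fin n} {D} (P : Pairing p D) → let open Pairing P in
  (∀ e f g → D e ≡ true → D f ≡ true → D g ≡ true → p e ≡ p f → p e ≡ p g →
    e ≡ f ⊎ e ≡ g ⊎ f ≡ g) →
  ∀ e f → D e ≡ true → D f ≡ true → p e ≡ p f → e ≢ f → mate e ≡ f
mate-of {p = p} {D} P two e f De Df pe e≢f with Pairing.mate P e ≟ f
... | yes eq = eq
... | no ne with Pairing.mate P e ≟ e
...   | no moved with two e f (mate e) De Df
                        (support (mate e) λ fix → moved (trans (sym fix) (involutive e)))
                        pe (sym (same-end e))
  where open Pairing P
...     | inj₁ eq        = contradiction eq e≢f
...     | inj₂ (inj₁ eq) = contradiction (sym eq) moved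
...     | inj₂ (inj₂ eq) = contradiction (sym eq) ne
mate-of {p = p} {D} P two e f De Df pe e≢f | no ne | yes fixed with Pairing.mate P f ≟ f
... | yes fixed′ = contradiction (Pairing.maximal P e f De Df pe fixed fixed′) e≢f
... | no moved with two e f (mate f) De Df
                        (support (mate f) λ fix → moved (trans (sym fix) (involutive f)))
                        pe (trans pe (sym (same-end f)))
  where open Pairing P
...     | inj₁ eq        = contradiction eq e≢f
...     | inj₂ (inj₁ eq) = contradiction
          (trans (cong (Pairing.mate P) eq) (Pairing.involutive P f)) ne
...     | inj₂ (inj₂ eq) = contradiction (sym eq) moved

-- The two ends of the edge e are end false e and end true e, on the two sides
-- of the bipartition.
separate : ∀ {m n} (end : Bool → Fin m → Fin n) D (P : ∀ s → Pairing (end s) D) →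
  ∃[ col ] ∀ s e → Pairing.mate (P s) e ≢ e → col (Pairing.mate (P s) e) ≡ not (col e)
separate {m} end D P = col , opposite
  where
  J : Slot m → Slot m
  J (e , s) = Pairing.mate (P s) e , s

  alternation = alternate J (λ (e , s) → cong (_, s) (Pairing.involutive (P s) e))
  col = proj₁ alternation

  -- Mates occupy slots of the same side `s`, so the twist by `s` in `value` affects both alike and
  -- cancels.
  strip : ∀ s {x y} → s xor x ≡ not (s xor y) → y ≡ not x
  strip true  {x} {y} eq = trans (sym (not-involutive y)) (sym eq)
  strip false {x} {y} eq = trans (sym (not-involutive y)) (cong not (sym eq))

  opposite : ∀ s e → Pairing.mate (P s) e ≢ e → col (Pairing.mate (P s) e) ≡ not (col e)
  opposite s e ne = strip s (proj₂ alternation (e , s) (J (e , s)) refl (ne ∘ sym ∘ cong proj₁))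

-- König's theorem: inserting an edge and recoloring.

-- The color x s is missing at the end s of the edge zero.  The edges with one
-- of these colors, together with zero, have at most two edges at each vertex,
-- and are recolored.
module Insertion {m n k} (end : Bool → Fin (suc m) → Fin n) (S : Fin (suc m) → Bool)
  (c : Fin m → Fin k) (proper : ∀ s → Proper (end s ∘ suc) (S ∘ suc) c)
  (x : Bool → Fin k)
  (missing : ∀ s e → S (suc e) ≡ true → end s (suc e) ≡ end s zero → c e ≢ x s)
  (x-distinct : x false ≢ x true)
  where

  x-injective : ∀ {s t} → x s ≡ x t → s ≡ t
  x-injective {false} {false} _  = refl
  x-injective {false} {true}  eq = contradiction eq x-distinct
  x-injective {true}  {false} eq = contradiction (sym eq) x-distinct
  x-injective {true}  {true}  _  = refl

  D : Fin (suc m) → Bool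
  D zero    = true
  D (suc e) = S (suc e) ∧ (does (c e ≟ x false) ∨ does (c e ≟ x true))

  free-color : ∀ a → does (a ≟ x false) ∨ does (a ≟ x true) ≡ true → ∃[ t ] a ≡ x t
  free-color a eq with a ≟ x false | a ≟ x true
  ... | yes a≡ | _      = false , a≡
  ... | no _   | yes a≡ = true , a≡

  D-suc : ∀ e → D (suc e) ≡ true → S (suc e) ≡ true × ∃[ t ] c e ≡ x t
  D-suc e De = let (Se , ce) = ∧-true De in Se , free-color (c e) ce

  suc-D : ∀ e t → S (suc e) ≡ true → c e ≡ x t → D (suc e) ≡ true
  suc-D e t Se eq rewrite Se with c e ≟ x false | c e ≟ x true
  ... | yes _ | _     = refl
  ... | no _  | yes _ = refl
  suc-D e false Se eq | no ne | no _  = contradiction eq ne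
  suc-D e true  Se eq | no _  | no ne = contradiction eq ne

  other : ∀ s t → t ≢ s → x t ≡ x (not s)
  other s t ne = cong x (¬-not ne)

  -- At the end `s` of `zero` the color `x s` is missing, so an edge of `D` there other than `zero`
  -- has color `x (not s)`, and properness allows only one such edge.
  two-at-zero : ∀ s f g → D (suc f) ≡ true → D (suc g) ≡ true →
    end s (suc f) ≡ end s zero → end s (suc g) ≡ end s zero → f ≡ g
  two-at-zero s f g Df Dg pf pg with D-suc f Df | D-suc g Dg
  ... | Sf , t , cf | Sg , u , cg = proper s f g Sf Sg (trans pf (sym pg)) (begin
    c f       ≡⟨ cf ⟩
    x t       ≡⟨ other s t (λ { refl → missing s f Sf pf cf }) ⟩
    x (not s) ≡⟨ other s u (λ { refl → missing s g Sg pg cg }) ⟨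
    x u       ≡⟨ cg ⟨
    c g       ∎)
    where open ≡-Reasoning

  -- Three old edges share only two colors, so two of them have the same color and coincide by
  -- properness. If `zero` is among the three, `two-at-zero` identifies the others.
  two : ∀ s e f g → D e ≡ true → D f ≡ true → D g ≡ true → end s e ≡ end s f → end s e ≡ end s g →
    e ≡ f ⊎ e ≡ g ⊎ f ≡ g
  two s zero    zero    _       _  _  _  _  _  = inj₁ refl
  two s zero    (suc f) zero    _  _  _  _  _  = inj₂ (inj₁ refl)
  two s (suc e) zero    zero    _  _  _  _  _  = inj₂ (inj₂ refl)
  two s zero    (suc f) (suc g) De Df Dg pf pg =
    inj₂ (inj₂ (cong suc (two-at-zero s f g Df Dg (sym pf) (sym pg))))
  two s (suc e) zero    (suc g) De Df Dg pf pg =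
    inj₂ (inj₁ (cong suc (two-at-zero s e g De Dg pf (trans (sym pg) pf))))
  two s (suc e) (suc f) zero    De Df Dg pf pg =
    inj₁ (cong suc (two-at-zero s e f De Df pg (trans (sym pf) pg)))
  two s (suc e) (suc f) (suc g) De Df Dg pf pg with D-suc e De | D-suc f Df | D-suc g Dg
  ... | Se , t , ce | Sf , u , cf | Sg , w , cg with t ≟ᵇ u | t ≟ᵇ w
  ...   | yes refl | _        = inj₁ (cong suc (proper s e f Se Sf pf (trans ce (sym cf))))
  ...   | no _     | yes refl = inj₂ (inj₁ (cong suc (proper s e g Se Sg pg (trans ce (sym cg)))))
  ...   | no t≢u   | no t≢w   = inj₂ (inj₂ (cong suc (proper s f g Sf Sg (trans (sym pf) pg)
            (trans cf (trans (other t u (t≢u ∘ sym)) (trans (sym (other t w (t≢w ∘ sym))) (sym cg)))))))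

  P : ∀ s → Pairing (end s) D
  P s = pairing (end s) D

  col = proj₁ (separate end D P)

  recolor : Fin (suc m) → Fin k
  recolor zero    = x (col zero)
  recolor (suc e) = if D (suc e) then x (col (suc e)) else c e

  data View : Fin (suc m) → Set where
    changed : ∀ {e} → D e ≡ true → recolor e ≡ x (col e) → View e
    kept    : ∀ {e} → D (suc e) ≡ false → recolor (suc e) ≡ c e → View (suc e)

  view : ∀ e → View e
  view zero = changed refl refl
  view (suc e) with D (suc e) in eq
  ... | true  = changed eq (cong (λ b → if b then x (col (suc e)) else c e) eq)
  ... | false = kept eq (cong (λ b → if b then x (col (suc e)) else c e) eq)

  kept-color : ∀ {e t} → S (suc e) ≡ true → D (suc e) ≡ false → c e ≢ x t
  kept-color {e} {t} Se ¬De eq with trans (sym (suc-D e t Se eq)) ¬De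
  ... | ()

  -- Kept edges have neither of the two colors, so they cannot clash with changed ones. Two distinct
  -- changed edges with a common end are mates by `mate-of`, and so receive different colors.
  recolor-proper : ∀ s → Proper (end s) S recolor
  recolor-proper s e f Se Sf pe ce with view e | view f
  ... | kept _ re | kept _ rf = cong suc (proper s _ _ Se Sf pe (trans (sym re) (trans ce rf)))
  ... | changed _ re | kept ¬Df rf =
        contradiction (trans (sym rf) (trans (sym ce) re)) (kept-color Sf ¬Df)
  ... | kept ¬De re | changed _ rf =
        contradiction (trans (sym re) (trans ce rf)) (kept-color Se ¬De)
  ... | changed De re | changed Df rf with e ≟ f
  ...   | yes eq = eq
  ...   | no e≢f = contradiction
          (trans (cong col (sym mate-e)) (proj₂ (separate end D P) s e λ fix → e≢f (trans (sym fix) mate-e)))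
          (not-¬ (sym col-e))
    where
    mate-e : Pairing.mate (P s) e ≡ f
    mate-e = mate-of (P s) (two s) e f De Df pe e≢f
    col-e : col e ≡ col f
    col-e = x-injective (trans (sym re) (trans ce rf))

-- Induction on the number of edges. At each end of `zero` the other edges number at most `k`, so
-- one of the `suc k` colors is free there. If the colors chosen at the two ends agree, `zero` takes
-- that color; otherwise `Insertion` recolors.
könig : ∀ {m n k} (end : Bool → Fin m → Fin n) S → (∀ s v → degree (end s) S v ≤ suc k) →
  ∃[ c ] ∀ s → Proper {k = suc k} (end s) S c
könig {zero}  end S d = (λ ()) , λ _ ()
könig {suc m} {n} {k} end S d = extend (S zero) refl
  where
  end⁻ : Bool → Fin m → Fin n
  end⁻ s = end s ∘ suc

  IH = könig end⁻ (S ∘ suc) λ s v → ℕ.≤-trans (ℕ.m≤n+m _ _) (d s v)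
  c      = proj₁ IH
  proper = proj₂ IH

  cons : Fin (suc k) → Fin (suc m) → Fin (suc k)
  cons a zero    = a
  cons a (suc e) = c e

  cons-proper : ∀ a →
    (∀ s e → S zero ≡ true → S (suc e) ≡ true → end s (suc e) ≡ end s zero → c e ≢ a) →
    ∀ s → Proper (end s) S (cons a)
  cons-proper a ok s zero    zero    _  _  _  _  = refl
  cons-proper a ok s zero    (suc f) S0 Sf pe ce = contradiction (sym ce) (ok s f S0 Sf (sym pe))
  cons-proper a ok s (suc e) zero    Se S0 pe ce = contradiction ce (ok s e S0 Se pe)
  cons-proper a ok s (suc e) (suc f) Se Sf pe ce = cong suc (proper s e f Se Sf pe ce)

  extend : ∀ b → S zero ≡ b → ∃[ c′ ] ∀ s → Proper {k = suc k} (end s) S c′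
  -- An edge outside `S` gets an arbitrary color.
  extend false S0 = cons zero , cons-proper zero λ s e S0′ → contradiction S0′ (subst (_≢ true) (sym S0) λ ())
  extend true  S0 = insert
    where
    degree< : ∀ s → degree (end⁻ s) (S ∘ suc) (end s zero) < suc k
    degree< s = subst (λ b → 𝟙 b + degree (end⁻ s) (S ∘ suc) (end s zero) ≤ suc k)
      (cong₂ _∧_ S0 (dec-true (end s zero ≟ end s zero) refl)) (d s (end s zero))

    free : ∀ s → ∃[ a ] ∀ e → S (suc e) ≡ true → end s (suc e) ≡ end s zero → c e ≢ a
    free s = missingColor (end⁻ s) (S ∘ suc) c (end s zero) (degree< s)

    x : Bool → Fin (suc k)
    x = proj₁ ∘ free

    insert : ∃[ c′ ] ∀ s → Proper {k = suc k} (end s) S c′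
    insert with x false ≟ x true
    ... | no  ne = recolor , recolor-proper
      where open Insertion end S c proper x (proj₂ ∘ free) ne
    ... | yes eq = cons (x false) , cons-proper (x false)
          λ { false e _ → proj₂ (free false) e
            ; true  e _ Se pe ce → proj₂ (free true) e Se pe (trans ce eq) }

-- Even division of two edge sets.

-- Membership in one half: common edges belong to both halves, and `h` decides only on the symmetric
-- difference, so that `not h` describes the complementary half.
half : Bool → Bool → Bool → Bool
half a b h = (a ∧ b) ∨ ((a xor b) ∧ h)

half-sum : ∀ a b h → 𝟙 (half a b h) + 𝟙 (half a b (not h)) ≡ 𝟙 a + 𝟙 b
half-sum true  true  _     = refl
half-sum true  false true  = refl
half-sum true  false false = refl
half-sum false true  true  = refl
half-sum false true  false = refl
half-sum false false _     = refl

half-sum-∧ : ∀ a b h w → 𝟙 (half a b h ∧ w) + 𝟙 (half a b (not h) ∧ w) ≡ 𝟙 (a ∧ w) + 𝟙 (b ∧ w)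
half-sum-∧ a b h true
  rewrite ∧-identityʳ (half a b h) | ∧-identityʳ (half a b (not h)) | ∧-identityʳ a | ∧-identityʳ b
  = half-sum a b h
half-sum-∧ a b h false
  rewrite ∧-zeroʳ (half a b h) | ∧-zeroʳ (half a b (not h)) | ∧-zeroʳ a | ∧-zeroʳ b
  = refl

-- Covers an edge that is its own mate, whose possible excess is paid for by the last summand. The
-- literal `true` is what `does (mate e ≟ e)` becomes in `unmatched`.
half-≤ : ∀ a b h w → 𝟙 (half a b h ∧ w) ≤ 𝟙 (half a b (not h) ∧ w) + 𝟙 (((a xor b) ∧ true) ∧ w)
half-≤ true  true  _     w = ℕ.m≤m+n (𝟙 w) 0
half-≤ true  false true  w = ℕ.≤-refl
half-≤ true  false false w = z≤n
half-≤ false true  true  w = ℕ.≤-refl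
half-≤ false true  false w = z≤n
half-≤ false false _     w = z≤n

half-xor : ∀ a b h → a xor b ≡ true → half a b h ≡ h
half-xor true  false _ _ = refl
half-xor false true  _ _ = refl

halves : ∀ {m} → (S₁ S₂ col : Fin m → Bool) → Fin m → Bool
halves S₁ S₂ col e = half (S₁ e) (S₂ e) (col e)

halves-degree : ∀ {m n} (p : Fin m → Fin n) S₁ S₂ col v →
  degree p (halves S₁ S₂ col) v + degree p (halves S₁ S₂ (not ∘ col)) v ≡ degree p S₁ v + degree p S₂ v
halves-degree p S₁ S₂ col v = ∑-exchange _ _ _ _ λ e →
  half-sum-∧ (S₁ e) (S₂ e) (col e) (does (p e ≟ v))

halves-size : ∀ {m} (S₁ S₂ col : Fin m → Bool) →
  # (halves S₁ S₂ col) + # (halves S₁ S₂ (not ∘ col)) ≡ # S₁ + # S₂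
halves-size S₁ S₂ col = ∑-exchange _ _ _ _ λ e → half-sum (S₁ e) (S₂ e) (col e)

-- The mate of an edge in one half lies in the other half, and at most one edge
-- at v is its own mate.
halves-balanced : ∀ {m n} (p : Fin m → Fin n) (S₁ S₂ col : Fin m → Bool)
  (P : Pairing p (λ e → S₁ e xor S₂ e)) → let open Pairing P in
  (∀ e → mate e ≢ e → col (mate e) ≡ not (col e)) →
  ∀ v → degree p (halves S₁ S₂ col) v ≤ degree p (halves S₁ S₂ (not ∘ col)) v + 1
halves-balanced p S₁ S₂ col P opposite v = begin
  degree p (halves S₁ S₂ col) v
    -- Reindexing by `mate` lets each edge be compared with its mate, term by term.
    ≡⟨ sum-permute _ (permutation mate mate involutive involutive) ⟩
  # (λ e → halves S₁ S₂ col (mate e) ∧ does (p (mate e) ≟ v))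
    ≤⟨ ∑-mono-≤ pointwise ⟩
  ∑ (λ e → 𝟙 (halves S₁ S₂ (not ∘ col) e ∧ does (p e ≟ v)) + 𝟙 (unmatched e))
    ≡⟨ ∑-distrib-+ (λ e → 𝟙 (halves S₁ S₂ (not ∘ col) e ∧ does (p e ≟ v))) (𝟙 ∘ unmatched) ⟩
  degree p (halves S₁ S₂ (not ∘ col)) v + # unmatched
    ≤⟨ ℕ.+-monoʳ-≤ _ (#-atMostOne unmatched unique) ⟩
  degree p (halves S₁ S₂ (not ∘ col)) v + 1 ∎
  where
  open ℕ.≤-Reasoning
  open Pairing P

  D unmatched : _ → Bool
  D e = S₁ e xor S₂ e
  unmatched e = (D e ∧ does (mate e ≟ e)) ∧ does (p e ≟ v)

  unique : ∀ e f → unmatched e ≡ true → unmatched f ≡ true → e ≡ f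
  unique e f ue uf =
    let (De∧ , pe) = ∧-true ue
        (Df∧ , pf) = ∧-true uf
        (De , ee) = ∧-true De∧
        (Df , ff) = ∧-true Df∧
    in maximal e f De Df
         (trans (does-true (p e ≟ v) pe) (sym (does-true (p f ≟ v) pf)))
         (does-true (mate e ≟ e) ee) (does-true (mate f ≟ f) ff)

  pointwise : ∀ e → 𝟙 (halves S₁ S₂ col (mate e) ∧ does (p (mate e) ≟ v)) ≤
                    𝟙 (halves S₁ S₂ (not ∘ col) e ∧ does (p e ≟ v)) + 𝟙 (unmatched e)
  pointwise e with mate e ≟ e
  ... | yes fixed rewrite fixed = half-≤ (S₁ e) (S₂ e) (col e) (does (p e ≟ v))
  ... | no moved = ℕ.≤-trans (ℕ.≤-reflexive (cong 𝟙 (cong₂ _∧_ swapped (cong (λ u → does (u ≟ v)) (same-end e)))))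
                             (ℕ.m≤m+n _ _)
    where
    swapped : halves S₁ S₂ col (mate e) ≡ halves S₁ S₂ (not ∘ col) e
    swapped = trans
      (half-xor (S₁ (mate e)) (S₂ (mate e)) _
        (support (mate e) λ fix → moved (trans (sym fix) (involutive e))))
      (trans (opposite e moved) (sym (half-xor (S₁ e) (S₂ e) _ (support e moved))))

-- If `x` were at least `2 + k`, then `y` would be at least `1 + k`, and the sum would exceed
-- `k + (2 + k)`.
half-bound : ∀ {x y k} → x ≤ y + 1 → x + y ≤ k + (2 + k) → x ≤ suc k
half-bound {x} {y} {k} x≤y+1 x+y≤ = ℕ.≮⇒≥ λ 2+k≤x → ℕ.<⇒≱
  (ℕ.+-mono-≤ (s≤s⁻¹ (ℕ.≤-trans 2+k≤x (ℕ.≤-trans x≤y+1 (ℕ.≤-reflexive (ℕ.+-comm y 1))))) 2+k≤x)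
  (ℕ.≤-trans (ℕ.≤-reflexive (ℕ.+-comm y x)) x+y≤)

-- At each vertex the degrees in the two halves sum to at most `k + (2 + k)` and differ by at most
-- one, so neither exceeds `suc k`.
divide : ∀ {m n k} (end : Bool → Fin m → Fin n) S₁ S₂ →
  (∀ s v → degree (end s) S₁ v ≤ k) → (∀ s v → degree (end s) S₂ v ≤ 2 + k) →
  ∃[ A ] ∃[ B ] (∀ s v → degree (end s) A v ≤ suc k) × (∀ s v → degree (end s) B v ≤ suc k) ×
    # A + # B ≡ # S₁ + # S₂
divide {k = k} end S₁ S₂ d₁ d₂ =
  halves S₁ S₂ col , halves S₁ S₂ (not ∘ col) , bound-A , bound-B , halves-size S₁ S₂ col
  where
  P : ∀ s → Pairing (end s) (λ e → S₁ e xor S₂ e)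
  P s = pairing (end s) _

  separation = separate end _ P
  col = proj₁ separation
  opposite = proj₂ separation

  total : ∀ s v → degree (end s) (halves S₁ S₂ col) v +
                  degree (end s) (halves S₁ S₂ (not ∘ col)) v ≤ k + (2 + k)
  total s v = ℕ.≤-trans (ℕ.≤-reflexive (halves-degree (end s) S₁ S₂ col v)) (ℕ.+-mono-≤ (d₁ s v) (d₂ s v))

  bound-A : ∀ s v → degree (end s) (halves S₁ S₂ col) v ≤ suc k
  bound-A s v = half-bound (halves-balanced (end s) S₁ S₂ col (P s) (opposite s) v) (total s v)

  bound-B : ∀ s v → degree (end s) (halves S₁ S₂ (not ∘ col)) v ≤ suc k
  -- Negating `col` exchanges the two halves; the resulting double negation is removed edge by edge.
  bound-B s v = half-bound
    (ℕ.≤-trans (halves-balanced (end s) S₁ S₂ (not ∘ col) (P s) (λ e ne → cong not (opposite s e ne)) v)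
      (ℕ.≤-reflexive (cong (_+ 1) (sum-cong-≗ λ e →
        cong (λ h → 𝟙 (half (S₁ e) (S₂ e) h ∧ does (end s e ≟ v))) (not-involutive (col e))))))
    (ℕ.≤-trans (ℕ.≤-reflexive (ℕ.+-comm (degree (end s) (halves S₁ S₂ (not ∘ col)) v) _)) (total s v))

-- Transfer to bipartite multigraphs.

∣S∣≡#lookup : ∀ {m} (S : Subset m) → ∣ S ∣ ≡ # (lookup S)
∣S∣≡#lookup []          = refl
∣S∣≡#lookup (true  ∷ S) = cong suc (∣S∣≡#lookup S)
∣S∣≡#lookup (false ∷ S) = ∣S∣≡#lookup S

∣tabulate∣ : ∀ {m} (P : Fin m → Bool) → ∣ tabulate P ∣ ≡ # P
∣tabulate∣ P = trans (∣S∣≡#lookup (tabulate P))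
  (sum-cong-≗ λ e → cong 𝟙 (lookup∘tabulate P e))

module _ (G : Multigraph) (bipartite : Bipartite G) where
  open Multigraph G

  side : V → Bool
  side = proj₁ bipartite

  -- Replaces the orientation of edges by the bipartition: the ends of `e` lie on different sides,
  -- so `tgt e` is on side `s` whenever `src e` is not.
  end : Bool → E → V
  end s e = if does (side (src e) ≟ᵇ s) then src e else tgt e

  end-incident : ∀ s e → Incident (end s e) e
  end-incident s e with side (src e) ≟ᵇ s
  ... | yes _ = inj₁ refl
  ... | no _  = inj₂ refl

  incident-end : ∀ {v e} → Incident v e → end (side v) e ≡ v
  incident-end {e = e} (inj₁ refl) with side (src e) ≟ᵇ side (src e)
  ... | yes _ = refl
  ... | no ne = contradiction refl ne
  incident-end {e = e} (inj₂ refl) with side (src e) ≟ᵇ side (tgt e)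
  ... | yes eq = contradiction eq (proj₂ bipartite e)
  ... | no _   = refl

  coloring⇒degree≤ : ∀ {k} S → EdgeColoring G S (suc k) → ∀ s v → degree (end s) (lookup S) v ≤ suc k
  coloring⇒degree≤ {k} S γ s = proper⇒degree≤ (end s) (lookup S) c c-proper
    where
    c : E → Fin (suc k)
    c e with e ∈? S
    ... | yes e∈S = EdgeColoring.color γ e e∈S
    -- A default outside `S`, where `Proper` demands nothing.
    ... | no _    = zero

    c-proper : Proper (end s) (lookup S) c
    c-proper e f Se Sf pe ce with e ∈? S | f ∈? S
    ... | no ∉  | _     = contradiction (lookup⇒[]= e S Se) ∉
    ... | yes _ | no ∉  = contradiction (lookup⇒[]= f S Sf) ∉
    ... | yes p | yes q with e ≟ f
    ...   | yes eq = eq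
    ...   | no ne  = contradiction ce (EdgeColoring.proper γ e f p q
              (ne , end s e , end-incident s e , subst (λ v → Incident v f) (sym pe) (end-incident s f)))

  degree≤⇒coloring : ∀ {k} S → (∀ s v → degree (end s) S v ≤ suc k) → EdgeColoring G (tabulate S) (suc k)
  degree≤⇒coloring {k} S d = record
    { color  = λ e _ → proj₁ (könig end S d) e
    ; proper = λ e f p q (e≢f , v , ve , vf) eq →
        -- Adjacent edges have the same end on the side of their common vertex `v`.
        e≢f (proj₂ (könig end S d) (side v) e f (member p) (member q)
          (trans (incident-end ve) (sym (incident-end vf))) eq)
    }
    where
    member : ∀ {e} → e ∈ tabulate S → S e ≡ true
    member {e} p = trans (sym (lookup∘tabulate S e)) ([]=⇒lookup p)

  -- The shift makes all three numbers of colors successors, as the passage between colorings and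
  -- degree bounds requires.
  ν-concave : ∀ k → ν G (1 + k) + ν G (3 + k) ≤ ν G (2 + k) + ν G (2 + k)
  ν-concave k
    with (S₁ , γ₁ , size₁) , _ ← ν-isMax G (1 + k)
       | (S₂ , γ₂ , size₂) , _ ← ν-isMax G (3 + k)
       | _ , max ← ν-isMax G (2 + k)
    with A , B , dA , dB , size ← divide end (lookup S₁) (lookup S₂)
                                    (coloring⇒degree≤ S₁ γ₁) (coloring⇒degree≤ S₂ γ₂) = begin
    ν G (1 + k) + ν G (3 + k)         ≡⟨ cong₂ _+_ size₁ size₂ ⟨
    ∣ S₁ ∣ + ∣ S₂ ∣                   ≡⟨ cong₂ _+_ (∣S∣≡#lookup S₁) (∣S∣≡#lookup S₂) ⟩
    # (lookup S₁) + # (lookup S₂)     ≡⟨ size ⟨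
    # A + # B                         ≡⟨ cong₂ _+_ (∣tabulate∣ A) (∣tabulate∣ B) ⟨
    ∣ tabulate A ∣ + ∣ tabulate B ∣   ≤⟨ ℕ.+-mono-≤ (max _ (degree≤⇒coloring A dA)) (max _ (degree≤⇒coloring B dB)) ⟩
    ν G (2 + k) + ν G (2 + k)         ∎
    where open ℕ.≤-Reasoning

-- The inequality in rational form.

/2-≤ : ∀ a b → a ≤ b + b → (+ b) / 1 ≥ (+ a) / 2
-- `mkℚᵘ` stores the denominator minus one, so 1 and 0 stand for the denominators 2 and 1.
/2-≤ a b a≤2b = toℚᵘ-cancel-≤ (ℚᵘ.≤-respˡ-≃ (ℚᵘ.≃-sym (toℚᵘ-fromℚᵘ (mkℚᵘ (+ a) 1)))
  (ℚᵘ.≤-respʳ-≃ (ℚᵘ.≃-sym (toℚᵘ-fromℚᵘ (mkℚᵘ (+ b) 0))) (*≤* cross)))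
  where
  cross : (+ a) ℤ.* (+ 1) ℤ.≤ (+ b) ℤ.* (+ 2)
  cross rewrite ℤ.*-identityʳ (+ a) | sym (ℤ.pos-* b 2) | ℕ.*-comm b 2 | ℕ.+-identityʳ b = ℤ.+≤+ a≤2b

theorem14 : (k : ℕ) → 2 ≤ k →
    (G : Multigraph) → Bipartite G → AtMostOneCycle G →
    (+ ν G k) / 1 ≥ (+ (ν G (k ∸ 1) + ν G (k + 1))) / 2
theorem14 (suc (suc k)) _ G bipartite _ rewrite ℕ.+-comm k 1 =
  /2-≤ (ν G (1 + k) + ν G (3 + k)) (ν G (2 + k)) (ν-concave G bipartite k)
theorem14 (suc zero) (s≤s ())
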